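{- Let $n \in \mathbb{N} = \{1,2,\dots\}$, let $\mathcal{SNM} := \{k \in \mathbb{N} : S_2(k) = \mathrm{nM}(k)\}$ and $\mathcal{SNM}_1 := \{k \in \mathbb{N} : S_2(k) = \mathrm{nM}_1(k)\}$. 1. $S_2(2^n - n) = 2^n$, and for all integers $k \ge 0$: $S_2(k) = 2^n$ if and only if $2^n - n \le k \le 2^n - 1$. 2. $2^n - n \in \mathcal{SNM}$, while $2^n - n + 1, \dots, 2^n - 1 \notin \mathcal{SNM}$. 3. If $n \ge 2$, then $2^n - n - 1 \in \mathcal{SNM}$ with $S_2(2^n - n - 1) = 2^n - 2$. 4. If $n \ge 3$, then $2^n - n + 1 \in \mathcal{SNM}_1$.
   Context: For an integer $k \ge 0$, $S_2(k)$ denotes the smallest integer $m \ge 0$ such that $2^k$ divides $m!$, with the convention $S_2(0) = 0$. $\mathrm{nM} : \mathbb{N} \to \mathbb{N}$ is the strictly increasing enumeration of the natural numbers $\ge 1$ that are not of the form $2^m - 1$, $m \in \mathbb{N}$ (initial values $2,4,5,6,8,9,10,11,12,13,14,16,17$). $\mathrm{nM}_1 : \mathbb{N} \to \mathbb{N}$ is defined by $\mathrm{nM}_1(2^m - m + 1) := \mathrm{nM}(2^m - m + 1) - 1 = 2^m$ for $m \ge 3$, and $\mathrm{nM}_1(k) := \mathrm{nM}(k)$ for all $k \in \mathbb{N}$ not of the form $2^m - m + 1$ with $m \ge 3$. -}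

module Defs where

open import Data.Nat
open import Data.Nat.Divisibility using (_∣_; _∣?_; m∣m*n)
open import Data.Nat.Properties
open import Data.Product using (∃; _×_; _,_; proj₁; proj₂)
open import Data.Sum using (inj₁; inj₂)
open import Level using (0ℓ)
open import Relation.Binary.PropositionalEquality using (_≡_; refl; sym; trans; cong)
open import Relation.Nullary using (¬_; yes; no; contradiction; ¬?; map′; _×-dec_)
open import Relation.Unary using (Pred; Decidable)

-- ℕ contains 0 here, so a range of positive integers is stated with an
-- explicit bound 1 ≤ m.

IsLeast : Pred ℕ 0ℓ → Pred ℕ 0ℓ
IsLeast P m = P m × (∀ j → P j → m ≤ j)

least : {P : Pred ℕ 0ℓ} → Decidable P → ∃ P → ∃ (IsLeast P)
least P? (b , Pb) = search P? b Pb
  where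
  search : {P : Pred ℕ 0ℓ} → Decidable P → ∀ b → P b → ∃ (IsLeast P)
  search P? zero Pb = 0 , Pb , λ _ _ → z≤n
  search P? (suc b) Pb with P? 0
  ... | yes P0 = 0 , P0 , λ _ _ → z≤n
  ... | no ¬P0 with search (λ i → P? (suc i)) b Pb
  ...   | m , Pm , m≤ = suc m , Pm , λ
          { zero    P0 → contradiction P0 ¬P0
          ; (suc j) Pj → s≤s (m≤ j Pj) }

n<2^n : ∀ n → n < 2 ^ n
n<2^n zero    = s≤s z≤n
n<2^n (suc n) = begin-strict
  suc n          ≤⟨ n<2^n n ⟩
  2 ^ n          <⟨ m<m*n (2 ^ n) 2 {{m^n≢0 2 n}} (s≤s (s≤s z≤n)) ⟩
  2 ^ n * 2      ≡⟨ *-comm (2 ^ n) 2 ⟩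
  2 ^ suc n      ∎
  where open ≤-Reasoning

m∣m! : ∀ m → 1 ≤ m → m ∣ m !
m∣m! (suc m) _ = m∣m*n (m !)

S₂-least : ∀ k → ∃ (IsLeast (λ m → 2 ^ k ∣ m !))
S₂-least k = least (λ m → 2 ^ k ∣? m !) (2 ^ k , m∣m! (2 ^ k) (m^n>0 2 k))

S₂ : ℕ → ℕ
S₂ k = proj₁ (S₂-least k)

S₂-isLeast : ∀ k → IsLeast (λ m → 2 ^ k ∣ m !) (S₂ k)
S₂-isLeast k = proj₂ (S₂-least k)

PowerMinusOne : Pred ℕ 0ℓ
PowerMinusOne x = ∃ λ m → 1 ≤ m × x ≡ 2 ^ m ∸ 1

powerMinusOne? : Decidable PowerMinusOne
powerMinusOne? x = map′
  (λ (m , _ , p) → m , p)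
  (λ (m , 1≤m , eq) → m , bound m eq , 1≤m , eq)
  (anyUpTo? (λ m → (1 ≤? m) ×-dec (x ≟ 2 ^ m ∸ 1)) (suc x))
  where
  bound : ∀ m → x ≡ 2 ^ m ∸ 1 → m < suc x
  bound m refl = s≤s (∸-monoˡ-≤ 1 (n<2^n m))

NextValue : ℕ → Pred ℕ 0ℓ
NextValue n x = n < x × ¬ PowerMinusOne x

next-least : ∀ n → ∃ (IsLeast (NextValue n))
next-least n = least
  (λ x → (n <? x) ×-dec ¬? (powerMinusOne? x))
  (2 ^ suc n , <-trans (n<1+n n) (n<2^n (suc n)) , even)
  where
  even : ¬ PowerMinusOne (2 ^ suc n)
  even (suc m , _ , eq) = even≢odd (2 ^ m) (2 ^ n)
    (sym (trans (cong suc eq) (m+[n∸m]≡n (m^n>0 2 (suc m)))))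

-- Only the values at k ≥ 1 are meaningful; nM 0 = 0 is a seed for the
-- recursion.
nM : ℕ → ℕ
nM zero    = 0
nM (suc k) = proj₁ (next-least (nM k))

nM-isLeast : ∀ k → IsLeast (NextValue (nM k)) (nM (suc k))
nM-isLeast k = proj₂ (next-least (nM k))

-- The next four facts say that nM, restricted to k ≥ 1, is the strictly
-- increasing enumeration of the positive integers not of the form 2^m - 1.

nM-mono-< : ∀ {k l} → k < l → nM k < nM l
nM-mono-< {k} {suc l} (s≤s k≤l) with m≤n⇒m<n∨m≡n k≤l
... | inj₁ k<l  = <-trans (nM-mono-< k<l) (proj₁ (proj₁ (nM-isLeast l)))
... | inj₂ refl = proj₁ (proj₁ (nM-isLeast l))

nM-positive : ∀ {k} → 1 ≤ k → 1 ≤ nM k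
nM-positive = nM-mono-<

nM-sound : ∀ {k} → 1 ≤ k → ¬ PowerMinusOne (nM k)
nM-sound {suc k} _ = proj₂ (proj₁ (nM-isLeast k))

nM-complete : ∀ {x} → 1 ≤ x → ¬ PowerMinusOne x → ∃ λ k → 1 ≤ k × nM k ≡ x
nM-complete {x} 1≤x ¬p = go x (k≤nM x)
  where
  k≤nM : ∀ k → k ≤ nM k
  k≤nM zero    = z≤n
  k≤nM (suc k) = ≤-<-trans (k≤nM k) (nM-mono-< (n<1+n k))

  go : ∀ k → x ≤ nM k → ∃ λ k → 1 ≤ k × nM k ≡ x
  go zero    x≤ = contradiction (≤-trans 1≤x x≤) λ ()
  go (suc k) x≤ with x ≤? nM k
  ... | yes x≤nMk = go k x≤nMk
  ... | no  x≰nMk = suc k , s≤s z≤n ,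
        ≤-antisym (proj₂ (nM-isLeast k) x (≰⇒> x≰nMk , ¬p)) x≤

Exceptional : Pred ℕ 0ℓ
Exceptional k = ∃ λ m → 3 ≤ m × k ≡ 2 ^ m ∸ m + 1

exceptional? : Decidable Exceptional
exceptional? k = map′
  (λ (m , _ , p) → m , p)
  (λ (m , 3≤m , eq) → m , bound m 3≤m eq , 3≤m , eq)
  (anyUpTo? (λ m → (3 ≤? m) ×-dec (k ≟ 2 ^ m ∸ m + 1)) k)
  where
  double : ∀ m → 1 ≤ m → m + m ≤ 2 ^ m
  double (suc m) _ = +-mono-≤ (n<2^n m) (≤-trans (n<2^n m) (m≤m+n (2 ^ m) 0))

  bound : ∀ m → 3 ≤ m → k ≡ 2 ^ m ∸ m + 1 → m < k
  bound m 3≤m refl = begin-strict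
    m              ≡⟨ m+n∸n≡m m m ⟨
    m + m ∸ m      ≤⟨ ∸-monoˡ-≤ m (double m (≤-trans (s≤s z≤n) 3≤m)) ⟩
    2 ^ m ∸ m      <⟨ m<m+n (2 ^ m ∸ m) (s≤s z≤n) ⟩
    2 ^ m ∸ m + 1  ∎
    where open ≤-Reasoning

nM₁ : ℕ → ℕ
nM₁ k with exceptional? k
... | yes _ = nM k ∸ 1
... | no  _ = nM k

SNM : Pred ℕ 0ℓ
SNM k = 1 ≤ k × S₂ k ≡ nM k

SNM₁ : Pred ℕ 0ℓ
SNM₁ k = 1 ≤ k × S₂ k ≡ nM₁ k

{-# OPTIONS --safe #-}

-- The exponent of 2 in (2m)! is m plus the exponent of 2 in m!. Applied to
-- 2m = 2^(n+1) - 2 this shows by induction that (2^n - 1)! has exponent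
-- 2^n - 1 - n, hence (2^n)! has exponent 2^n - 1. As S₂ k ≤ m iff k is at most
-- the exponent of 2 in m!, this determines the k with S₂ k = 2^n. On the other
-- side, nM skips exactly one number between 2^n - 2 and 2^n and none from 2^n
-- to 2^(n+1) - 2, so nM (2^n - n + i) = 2^n + i for i ≤ 2^n - 2.
module Submission where

open import Data.Nat using (ℕ; zero; suc; _+_; _*_; _∸_; _^_; _!; _≤_; _<_; _≰_; z≤n; s≤s)
open import Data.Nat.Divisibility
  using (_∣_; divides; ∣-trans; m∣m*n; *-monoʳ-∣; *-cancelˡ-∣; m≤n⇒m!∣n!)
open import Data.Nat.Properties
open import Data.Nat.Tactic.RingSolver using (solve-∀)
open import Data.Product using (∃; _×_; _,_; proj₁; proj₂)
open import Function.Bundles using (_⇔_; mk⇔; Equivalence)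
open import Relation.Binary.PropositionalEquality
  using (_≡_; refl; sym; trans; cong; cong₂; subst; module ≡-Reasoning)
open import Relation.Nullary using (¬_; yes; no; contradiction)
open import Relation.Unary using (_∈_; _∉_)
open import Defs

-- The exponent of 2 in `x` is `v`, and `x` is nonzero. Giving the cofactor as an explicit odd
-- number makes additivity under products a polynomial identity.
record HasVal (x v : ℕ) : Set where
  constructor _,_
  field
    half    : ℕ
    factors : x ≡ 2 ^ v * suc (2 * half)

hasVal-odd : ∀ q → HasVal (suc (2 * q)) 0
hasVal-odd q = q , sym (*-identityˡ _)

hasVal-2^ : ∀ n → HasVal (2 ^ n) n
hasVal-2^ n = 0 , sym (*-identityʳ _)

hasVal-* : ∀ {x y v w} → HasVal x v → HasVal y w → HasVal (x * y) (v + w)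
hasVal-* {v = v} {w} (q , refl) (r , refl) = q + r + 2 * (q * r) , (begin
  2 ^ v * suc (2 * q) * (2 ^ w * suc (2 * r))
    ≡⟨ regroup (2 ^ v) (2 ^ w) q r ⟩
  2 ^ v * 2 ^ w * suc (2 * (q + r + 2 * (q * r)))
    ≡⟨ cong (_* suc (2 * (q + r + 2 * (q * r)))) (^-distribˡ-+-* 2 v w) ⟨
  2 ^ (v + w) * suc (2 * (q + r + 2 * (q * r))) ∎)
  where
  open ≡-Reasoning
  regroup : ∀ a b q r →
    a * suc (2 * q) * (b * suc (2 * r)) ≡ a * b * suc (2 * (q + r + 2 * (q * r)))
  regroup = solve-∀

2^-mono-∣ : ∀ {v w} → v ≤ w → 2 ^ v ∣ 2 ^ w
2^-mono-∣ {v} v≤w with m≤n⇒∃[o]m+o≡n v≤w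
... | d , refl = subst (2 ^ v ∣_) (sym (^-distribˡ-+-* 2 v d)) (m∣m*n (2 ^ d))

hasVal⇒∣⇔≤ : ∀ {x v} → HasVal x v → ∀ k → 2 ^ k ∣ x ⇔ k ≤ v
hasVal⇒∣⇔≤ {v = v} (q , refl) k = mk⇔ bound (λ k≤v → ∣-trans (2^-mono-∣ k≤v) (m∣m*n _))
  where
  bound : 2 ^ k ∣ 2 ^ v * suc (2 * q) → k ≤ v
  bound 2^k∣ = ≮⇒≥ λ v<k → odd (*-cancelˡ-∣ (2 ^ v) {{m^n≢0 2 v}}
    (subst (_∣ 2 ^ v * suc (2 * q)) (*-comm 2 (2 ^ v)) (∣-trans (2^-mono-∣ v<k) 2^k∣)))
    where
    odd : ¬ 2 ∣ suc (2 * q)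
    odd (divides r eq) = even≢odd r q (trans (*-comm 2 r) (sym eq))

-- Each step from m to m + 1 brings in the odd factor 2m + 1 and the factor 2m + 2 = 2 (m + 1), so
-- `suc (2 * q)` is the product of the odd numbers below 2m.
double! : ∀ m → ∃ λ q → (2 * m) ! ≡ 2 ^ m * (m ! * suc (2 * q))
double! zero    = 0 , refl
double! (suc m) with double! m
... | q , eq = m + q + 2 * (m * q) , (begin
  (2 * suc m) !
    ≡⟨ cong _! (*-suc 2 m) ⟩
  suc (suc (2 * m)) * (suc (2 * m) * (2 * m) !)
    ≡⟨ cong (λ x → suc (suc (2 * m)) * (suc (2 * m) * x)) eq ⟩
  suc (suc (2 * m)) * (suc (2 * m) * (2 ^ m * (m ! * suc (2 * q))))
    ≡⟨ regroup (2 ^ m) (m !) m q ⟩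
  2 ^ suc m * (suc m ! * suc (2 * (m + q + 2 * (m * q)))) ∎)
  where
  open ≡-Reasoning
  regroup : ∀ a b m q →
    suc (suc (2 * m)) * (suc (2 * m) * (a * (b * suc (2 * q)))) ≡
    2 * a * (suc m * b * suc (2 * (m + q + 2 * (m * q))))
  regroup = solve-∀

hasVal-[2m]! : ∀ m {v} → HasVal (m !) v → HasVal ((2 * m) !) (m + v)
hasVal-[2m]! m {v} val with double! m
... | q , eq = subst (λ x → HasVal x (m + v)) (sym eq)
  (hasVal-* (hasVal-2^ m)
    (subst (HasVal _) (+-identityʳ v) (hasVal-* val (hasVal-odd q))))

hasVal-[1+2m]! : ∀ m {v} → HasVal ((2 * m) !) v → HasVal (suc (2 * m) !) v
hasVal-[1+2m]! m = hasVal-* (hasVal-odd m)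

-- A natural u with 2 ^ n ≡ suc (n + u) stands for 2 ^ n ∸ n ∸ 1, so that no
-- truncated subtraction occurs.
2^-split : ∀ n → ∃ λ u → 2 ^ n ≡ suc (n + u)
2^-split n with m≤n⇒∃[o]m+o≡n (n<2^n n)
... | u , eq = u , sym eq

2^n∸n : ∀ n {u} → 2 ^ n ≡ suc (n + u) → 2 ^ n ∸ n ≡ suc u
2^n∸n n {u} eq =
  trans (cong (_∸ n) (trans eq (sym (+-suc n u)))) (m+n∸m≡n n (suc u))

-- Here `n + w` is 2^n - 1 and `n + u` is 2^(n+1) - 2.
double-split : ∀ n {u w} → 2 ^ n ≡ suc (n + w) → 2 ^ suc n ≡ suc (suc n + u) →
               n + u ≡ 2 * (n + w) × u ≡ n + w + w
double-split n {u} {w} eq eq⁺ = even , +-cancelˡ-≡ n _ _ (trans even (regroup n w))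
  where
  even : n + u ≡ 2 * (n + w)
  even = suc-injective (suc-injective
    (trans (sym eq⁺) (trans (cong (2 *_) eq) (*-suc 2 (n + w)))))
  regroup : ∀ n w → 2 * (n + w) ≡ n + (n + w + w)
  regroup = solve-∀

hasVal-[2^n∸1]! : ∀ n {u} → 2 ^ n ≡ suc (n + u) → HasVal ((n + u) !) u

-- The exponent is shifted by one: `n + u` is 2^(n+1) - 2, the double of 2^n - 1. The induction
-- alternates between doubling and appending the odd factor 2^(n+1) - 1.
hasVal-[2^n∸2]! : ∀ n {u} → 2 ^ suc n ≡ suc (suc n + u) → HasVal ((n + u) !) u
hasVal-[2^n∸2]! n eq⁺ with 2^-split n
... | w , eq with double-split n eq eq⁺
...   | even , refl rewrite even = hasVal-[2m]! (n + w) (hasVal-[2^n∸1]! n eq)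

hasVal-[2^n∸1]! zero    refl = hasVal-odd 0
hasVal-[2^n∸1]! (suc n) {u} eq⁺ with 2^-split n
... | w , eq = subst (λ x → HasVal (suc x !) u) (sym even)
  (hasVal-[1+2m]! (n + w) (subst (λ x → HasVal (x !) u) even (hasVal-[2^n∸2]! n eq⁺)))
  where
  even : n + u ≡ 2 * (n + w)
  even = proj₁ (double-split n eq eq⁺)

hasVal-[2^n]! : ∀ n {u} → 2 ^ n ≡ suc (n + u) → HasVal (suc (n + u) !) (n + u)
hasVal-[2^n]! n eq =
  hasVal-* (subst (λ x → HasVal x n) eq (hasVal-2^ n)) (hasVal-[2^n∸1]! n eq)

S₂≤⇔∣ : ∀ k m → S₂ k ≤ m ⇔ 2 ^ k ∣ m !
S₂≤⇔∣ k m = mk⇔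
  (λ S₂k≤m → ∣-trans (proj₁ (S₂-isLeast k)) (m≤n⇒m!∣n! S₂k≤m))
  (proj₂ (S₂-isLeast k) m)

hasVal⇒S₂≤⇔≤ : ∀ m {v} → HasVal (m !) v → ∀ k → S₂ k ≤ m ⇔ k ≤ v
hasVal⇒S₂≤⇔≤ m val k = mk⇔
  (λ S₂k≤m → to (hasVal⇒∣⇔≤ val k) (to (S₂≤⇔∣ k m) S₂k≤m))
  (λ k≤v → from (S₂≤⇔∣ k m) (from (hasVal⇒∣⇔≤ val k) k≤v))
  where open Equivalence

-- The exponent of 2 jumps from `u` in (2^n - 1)! to `n + u` in (2^n)!, and the window consists of
-- the k covered by this jump.
S₂≡2^n⇔ : ∀ n {u} → 2 ^ n ≡ suc (n + u) →
          ∀ k → S₂ k ≡ suc (n + u) ⇔ (suc u ≤ k × k ≤ n + u)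
S₂≡2^n⇔ n eq k = mk⇔
  (λ S₂k≡ → ≰⇒> (λ k≤u → 1+n≰n (≤-trans (≤-reflexive (sym S₂k≡)) (from below k≤u)))
          , to upto (≤-reflexive S₂k≡))
  (λ (u<k , k≤) → ≤-antisym (from upto k≤) (≰⇒> λ S₂k≤ → <⇒≱ u<k (to below S₂k≤)))
  where
  open Equivalence
  below = hasVal⇒S₂≤⇔≤ (n + _) (hasVal-[2^n∸1]! n eq) k
  upto  = hasVal⇒S₂≤⇔≤ (suc (n + _)) (hasVal-[2^n]! n eq) k

-- Passing from (2m)! to (2m - 1)! loses at least one factor 2.
S₂-even : ∀ m {v} → HasVal ((2 * m) !) v → S₂ v ≡ 2 * m
S₂-even zero    {v} val = n≤0⇒n≡0 (Equivalence.from (hasVal⇒S₂≤⇔≤ 0 val v) ≤-refl)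
S₂-even (suc m) {v} val = ≤-antisym (from (hasVal⇒S₂≤⇔≤ (2 * suc m) val v) ≤-refl) (≰⇒> drop)
  where
  open Equivalence
  -- `m + suc (m + 0)` is what the predecessor of `2 * suc m` reduces to.
  drop : S₂ v ≰ m + suc (m + 0)
  drop S₂v≤ = 1+n≰n (to (hasVal⇒∣⇔≤ val (suc v)) (∣-trans
    (*-monoʳ-∣ 2 (to (S₂≤⇔∣ v _) S₂v≤))
    (divides (suc m) (regroup m ((m + suc (m + 0)) !)))))
    where
    regroup : ∀ m x → suc (m + suc (m + 0)) * x ≡ suc m * (2 * x)
    regroup = solve-∀

S₂[2^n∸n∸1] : ∀ n {u} → 2 ^ suc n ≡ suc (suc n + u) → S₂ u ≡ n + u
S₂[2^n∸n∸1] n {u} eq⁺ with 2^-split n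
... | w , eq = trans (S₂-even (n + w) (subst (λ x → HasVal (x !) u) even (hasVal-[2^n∸2]! n eq⁺))) (sym even)
  where
  even : n + u ≡ 2 * (n + w)
  even = proj₁ (double-split n eq eq⁺)

-- For m ≤ n the number 2^m - 1 is below 2^n, and for m > n it is at least 2^(n+1) - 1.
2^≤∧<⇒¬powerMinusOne : ∀ n {x} → 2 ^ n ≤ x → suc x < 2 ^ suc n → ¬ PowerMinusOne x
2^≤∧<⇒¬powerMinusOne n 2^n≤x 1+x<2^1+n (m , _ , refl) with m ≤? n
... | yes m≤n = <⇒≱ (m^n>0 2 m) (x≤x∸1⇒x≤0 (≤-trans (^-monoʳ-≤ 2 m≤n) 2^n≤x))
  where
  x≤x∸1⇒x≤0 : ∀ {x} → x ≤ x ∸ 1 → x ≤ 0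
  x≤x∸1⇒x≤0 {zero}  _ = z≤n
  x≤x∸1⇒x≤0 {suc x} p = contradiction p 1+n≰n
... | no m≰n = <⇒≱ 1+x<2^1+n (≤-trans (^-monoʳ-≤ 2 (≰⇒> m≰n))
  (≤-reflexive (sym (m+[n∸m]≡n (m^n>0 2 m)))))

nM-suc : ∀ {k x} → nM k ≡ x → ¬ PowerMinusOne (suc x) → nM (suc k) ≡ suc x
nM-suc {k} refl ¬p = ≤-antisym
  (proj₂ (nM-isLeast k) _ (≤-refl , ¬p))
  (nM-mono-< (n<1+n k))

nM-skip : ∀ {k x} → nM k ≡ x → PowerMinusOne (suc x) → ¬ PowerMinusOne (2 + x) →
          nM (suc k) ≡ 2 + x
nM-skip {k} refl p ¬p = ≤-antisym
  (proj₂ (nM-isLeast k) _ (n≤1+n _ , ¬p))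
  (≤∧≢⇒< (nM-mono-< (n<1+n k)) λ eq →
    nM-sound {suc k} (s≤s z≤n) (subst PowerMinusOne eq p))

-- Proved jointly with the next lemma by induction on `n`: the end of each run of consecutive values
-- is the starting point for the next one.
nM[2^n∸n∸1] : ∀ n {u} → 2 ^ suc n ≡ suc (suc n + u) → nM u ≡ n + u

nM[2^n∸n+i] : ∀ n {u} → 2 ^ suc n ≡ suc (suc n + u) →
              ∀ i → i ≤ n + u → nM (suc u + i) ≡ suc (suc n + u) + i
nM[2^n∸n+i] n {u} eq = run
  where
  gap : ∀ {i} → i ≤ n + u → ¬ PowerMinusOne (suc (suc n + u) + i)
  gap {i} i≤ = 2^≤∧<⇒¬powerMinusOne (suc n)
    (≤-trans (≤-reflexive eq) (m≤m+n _ i)) (begin-strict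
    suc (suc (suc n + u) + i)          ≡⟨ +-suc (suc (suc n + u)) i ⟨
    suc (suc n + u) + suc i            <⟨ +-monoʳ-< (suc (suc n + u)) (s≤s (s≤s i≤)) ⟩
    suc (suc n + u) + suc (suc n + u)  ≡⟨ cong₂ _+_ eq eq ⟨
    2 ^ suc n + 2 ^ suc n              ≡⟨ cong (2 ^ suc n +_) (+-identityʳ _) ⟨
    2 ^ suc (suc n)                    ∎)
    where open ≤-Reasoning

  run : ∀ i → i ≤ n + u → nM (suc u + i) ≡ suc (suc n + u) + i
  -- Only this first step jumps, over 2^(n+1) - 1; all later ones have length one.
  run zero _ rewrite +-identityʳ u = trans
    (nM-skip {u} (nM[2^n∸n∸1] n eq) (suc n , s≤s z≤n , cong (_∸ 1) (sym eq))
      (subst (λ x → ¬ PowerMinusOne x) (+-identityʳ _) (gap z≤n)))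
    (sym (+-identityʳ _))
  run (suc i) i< = trans (cong nM (+-suc (suc u) i))
    (trans (nM-suc {suc u + i} (run i (<⇒≤ i<))
             (subst (λ x → ¬ PowerMinusOne x) (+-suc (suc (suc n + u)) i) (gap i<)))
           (sym (+-suc (suc (suc n + u)) i)))

-- Here `u` is 0, and the claim is about the seed `nM 0`.
nM[2^n∸n∸1] zero    refl = refl
nM[2^n∸n∸1] (suc n) {u} eq⁺ with 2^-split (suc n)
-- `n + w` is the largest offset in the preceding run, whose last value is 2^(n+2) - 2.
... | w , eq = trans (cong nM u≡) (trans (nM[2^n∸n+i] n eq (n + w) ≤-refl) value)
  where
  u≡ : u ≡ suc w + (n + w)
  u≡ = trans (proj₂ (double-split (suc n) eq eq⁺)) (cong suc (+-comm (n + w) w))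
  value : suc (suc n + w) + (n + w) ≡ suc n + u
  value = sym (trans (proj₁ (double-split (suc n) eq eq⁺)) (regroup n w))
    where
    regroup : ∀ n w → 2 * (suc n + w) ≡ suc (suc n + w) + (n + w)
    regroup = solve-∀

nM[2^n∸n] : ∀ n {u} → 2 ^ suc n ≡ suc (suc n + u) → nM (suc u) ≡ suc (suc n + u)
nM[2^n∸n] n {u} eq = trans (cong nM (sym (+-identityʳ (suc u))))
  (trans (nM[2^n∸n+i] n eq 0 z≤n) (+-identityʳ _))

nM₁-exceptional : ∀ {k} → Exceptional k → nM₁ k ≡ nM k ∸ 1
nM₁-exceptional {k} e with exceptional? k
... | yes _ = refl
... | no ¬e = contradiction e ¬e

lemma6p5 : (n : ℕ) → 1 ≤ n →
    (S₂ (2 ^ n ∸ n) ≡ 2 ^ n ×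
    ((k : ℕ) → S₂ k ≡ 2 ^ n ⇔ (2 ^ n ∸ n ≤ k × k ≤ 2 ^ n ∸ 1)))
    × (2 ^ n ∸ n ∈ SNM ×
    ((k : ℕ) → 2 ^ n ∸ n + 1 ≤ k → k ≤ 2 ^ n ∸ 1 → k ∉ SNM))
    × (2 ≤ n → 2 ^ n ∸ n ∸ 1 ∈ SNM × S₂ (2 ^ n ∸ n ∸ 1) ≡ 2 ^ n ∸ 2)
    × (3 ≤ n → 2 ^ n ∸ n + 1 ∈ SNM₁)
lemma6p5 (suc m) _ with 2^-split (suc m)
... | u , eq
  -- The difference is rewritten first, while the power inside it is still intact.
  rewrite 2^n∸n (suc m) eq
        | eq
  = (S₂≡ ≤-refl (s≤s (m≤n+m u m)) , window)
  , ((s≤s z≤n , trans (S₂≡ ≤-refl (s≤s (m≤n+m u m))) (sym (nM[2^n∸n] m eq))) , notSNM)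
  , (λ 2≤n → (positive 2≤n , trans (S₂[2^n∸n∸1] m eq) (sym (nM[2^n∸n∸1] m eq)))
           , S₂[2^n∸n∸1] m eq)
  , λ 3≤n → s≤s z≤n , trans (S₂≡ (m≤m+n (suc u) 1) (second 3≤n)) (sym (nM₁≡ 3≤n))
  where
  window : ∀ k → S₂ k ≡ suc (suc m + u) ⇔ (suc u ≤ k × k ≤ suc m + u)
  window = S₂≡2^n⇔ (suc m) eq

  S₂≡ : ∀ {k} → suc u ≤ k → k ≤ suc m + u → S₂ k ≡ suc (suc m + u)
  S₂≡ {k} u<k k≤ = Equivalence.from (window k) (u<k , k≤)

  notSNM : ∀ k → suc u + 1 ≤ k → k ≤ suc m + u → k ∉ SNM
  -- `S₂` is constant on the window, whereas `nM` agrees with it at `suc u` and then strictly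
  -- increases.
  notSNM k lower upper (_ , S₂k≡nMk) = <⇒≢ (nM-mono-< u+1<k) (begin
    nM (suc u)       ≡⟨ nM[2^n∸n] m eq ⟩
    suc (suc m + u)  ≡⟨ S₂≡ (<⇒≤ u+1<k) upper ⟨
    S₂ k             ≡⟨ S₂k≡nMk ⟩
    nM k             ∎)
    where
    open ≡-Reasoning
    u+1<k : suc u < k
    u+1<k = subst (_≤ k) (+-comm (suc u) 1) lower

  positive : 2 ≤ suc m → 1 ≤ u
  -- For `u` equal to 0, the seed `nM 0` would have to equal `m`.
  positive (s≤s 1≤m) = n≢0⇒n>0 λ { refl →
    <⇒≢ 1≤m (trans (nM[2^n∸n∸1] m eq) (+-identityʳ m)) }

  second : 3 ≤ suc m → suc u + 1 ≤ suc m + u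
  second (s≤s 2≤m) = s≤s (subst (u + 1 ≤_) (+-comm u m) (+-monoʳ-≤ u (<⇒≤ 2≤m)))

  nM₁≡ : 3 ≤ suc m → nM₁ (suc u + 1) ≡ suc (suc m + u)
  -- Offset 1 in the run has the value 2^(m+1) + 1, which the exceptional clause lowers to 2^(m+1).
  nM₁≡ 3≤n@(s≤s 2≤m) = begin
    nM₁ (suc u + 1)          ≡⟨ nM₁-exceptional (suc m , 3≤n , cong (_+ 1) (sym (2^n∸n (suc m) eq))) ⟩
    nM (suc u + 1) ∸ 1       ≡⟨ cong (_∸ 1) (nM[2^n∸n+i] m eq 1 (≤-trans (<⇒≤ 2≤m) (m≤m+n m u))) ⟩
    suc (suc m + u) + 1 ∸ 1  ≡⟨ m+n∸n≡m (suc (suc m + u)) 1 ⟩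
    suc (suc m + u)          ∎
    where
    open ≡-Reasoning
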